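{- $\mathsf{ML}^{\mathsf{FO}}$ is equally expressive as $\mathsf{MTL}$: a team property is expressible in $\mathsf{ML}^{\mathsf{FO}}$ if and only if it is expressible in $\mathsf{MTL}$.
   Context: Fix a finite nonempty set $X$ of propositional variables. A Kripke model is $M=(W,R,\pi)$ with $W$ a nonempty set, $R\subseteq W\times W$, $\pi\colon X\to 2^W$. A team of $M$ is a set $T\subseteq W$. $\mathsf{ML}$ has syntax $\varphi ::= p\mid\neg p\mid(\varphi\wedge\varphi)\mid(\varphi\vee\varphi)\mid\Diamond\varphi\mid\Box\varphi$, $p\in X$. Team semantics, for $T\subseteq W$ (possibly empty): - $M,T\models p$ iff $T\subseteq\pi(p)$; $M,T\models\neg p$ iff $T\cap\pi(p)=\emptyset$; - $M,T\models\psi\wedge\chi$ iff $M,T\models\psi$ and $M,T\models\chi$; - $M,T\models\psi\vee\chi$ iff $T=T_1\cup T_2$ for some $T_1,T_2$ with $M,T_1\models\psi$ and $M,T_2\models\chi$; - $M,T\models\Diamond\psi$ iff there is a team $T'$ of $M$ with $M,T'\models\psi$ such that each $w\in T$ has some $w'\in T'$ with $(w,w')\in R$ and each $w'\in T'$ has some $w\in T$ with $(w,w')\in R$; - $M,T\models\Box\psi$ iff $M,T'\models\psi$ where $T'=\{w'\in W : (w,w')\in R\text{ for some }w\in T\}$. Each logic below extends the formation rules of $\mathsf{ML}$ (so the new formulas may occur under all connectives of the logic), and in each of them $p,\neg p,\wedge,\vee,\Diamond,\Box$ are interpreted by the team semantics of $\mathsf{ML}$, with $\psi,\chi$ ranging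 over all formulas of that logic. $\mathsf{MTL}$ (modal team logic): adds ${\sim}\psi$, with $M,T\models{\sim}\psi$ iff $M,T\not\models\psi$. $\mathsf{ML}^{\mathsf{FO}}$: adds all generalized dependence atoms that are first-order definable without identity, applied to arbitrary $\mathsf{ML}$-formulas. That is, for each $n$ and each first-order sentence $\phi$ without the equality symbol over the signature $\langle A_1,\dots,A_n\rangle$ of $n$ unary relation symbols there is an atom $D=D_\phi$ of width $n$, and $D(\varphi_1,\dots,\varphi_n)$ is a formula for all $\mathsf{ML}$-formulas $\varphi_1,\dots,\varphi_n$, with $M,T\models D(\varphi_1,\dots,\varphi_n)$ iff $\mathcal A\models\phi$, where $\mathcal A$ is the first-order structure with universe $T$ and $A_i^{\mathcal A}=\{w\in T : M,\{w\}\models\varphi_i\}$ for $1\le i\le n$. (If $T=\emptyset$, the universe is empty, existential statements are false and universal statements are true.) A team property is a class of pairs $(M,T)$ where $M$ is a Kripke model and $T\neq\emptyset$ is a team of $M$; it is expressible in a logic if for some formula $\varphi$ of the logic it equals the class of all $(M,T)$, $T\neq\emptyset$, with $M,T\models\varphi$. -}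

module Defs where

open import Data.Fin using (Fin)
open import Data.Nat using (ℕ; suc)
open import Data.Product using (Σ; Σ-syntax; ∃; ∃₂; _×_; _,_; proj₁)
open import Data.Sum using (_⊎_)
open import Data.Vec using (Vec; lookup)
import Data.Vec.Functional as Vector
open Vector using (Vector)
open import Level using (Level; Lift; 0ℓ; _⊔_) renaming (suc to lsuc)
open import Relation.Binary using (Rel)
open import Relation.Nullary using (¬_)
open import Relation.Unary using (Pred; _∈_; _⊆_; _∩_; _∪_; _≐_; ｛_｝; Empty)

-- Non-emptiness is a negated statement, here and in `TeamModel`, so that
-- neither a Kripke model nor a team carries a distinguished world.
record KripkeModel (X : Set) : Set₁ where
  field
    World    : Set
    nonempty : ¬ ¬ World
    R        : Rel World 0ℓ
    π        : X → Pred World 0ℓ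

open KripkeModel public using (World)

Team : {X : Set} → KripkeModel X → Set₁
Team M = Pred (World M) 0ℓ

------------------------------------------------------------------------
-- Team semantics of the connectives, shared by all the logics

module TeamSemantics {X : Set} (M : KripkeModel X) where
  open KripkeModel M using (R; π)

  -- `Lift` only raises the universe level: splitting and ◇ quantify over
  -- teams, so satisfaction lives in Set₁.
  Pos : X → Pred (Team M) (lsuc 0ℓ)
  Pos p T = Lift (lsuc 0ℓ) (T ⊆ π p)

  Neg : X → Pred (Team M) (lsuc 0ℓ)
  Neg p T = Lift (lsuc 0ℓ) (Empty (T ∩ π p))

  And : (P Q : Pred (Team M) (lsuc 0ℓ)) → Pred (Team M) (lsuc 0ℓ)
  And P Q T = P T × Q T

  Or : (P Q : Pred (Team M) (lsuc 0ℓ)) → Pred (Team M) (lsuc 0ℓ)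
  Or P Q T = ∃₂ λ (T₁ T₂ : Team M) → T ≐ (T₁ ∪ T₂) × P T₁ × Q T₂

  Diamond : Pred (Team M) (lsuc 0ℓ) → Pred (Team M) (lsuc 0ℓ)
  Diamond P T = ∃ λ (T′ : Team M) →
      P T′
    × (∀ w → w ∈ T → ∃ λ w′ → w′ ∈ T′ × R w w′)
    × (∀ w′ → w′ ∈ T′ → ∃ λ w → w ∈ T × R w w′)

  image : Team M → Team M
  image T w′ = ∃ λ w → w ∈ T × R w w′

  Box : Pred (Team M) (lsuc 0ℓ) → Pred (Team M) (lsuc 0ℓ)
  Box P T = P (image T)

open TeamSemantics

infix  9 ∼_
infixr 7 _∧_
infixr 6 _∨_

------------------------------------------------------------------------
-- Modal logic

data ML (X : Set) : Set where
  var  : X → ML X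
  ¬var : X → ML X
  _∧_  : ML X → ML X → ML X
  _∨_  : ML X → ML X → ML X
  ◇    : ML X → ML X
  □    : ML X → ML X

infix 3 _∣_⊨ML_

_∣_⊨ML_ : {X : Set} (M : KripkeModel X) → Team M → ML X → Set₁
M ∣ T ⊨ML var p   = Pos M p T
M ∣ T ⊨ML ¬var p  = Neg M p T
M ∣ T ⊨ML (φ ∧ ψ) = And M (M ∣_⊨ML φ) (M ∣_⊨ML ψ) T
M ∣ T ⊨ML (φ ∨ ψ) = Or M (M ∣_⊨ML φ) (M ∣_⊨ML ψ) T
M ∣ T ⊨ML ◇ φ     = Diamond M (M ∣_⊨ML φ) T
M ∣ T ⊨ML □ φ     = Box M (M ∣_⊨ML φ) T

------------------------------------------------------------------------
-- Modal team logic

data MTL (X : Set) : Set where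
  var  : X → MTL X
  ¬var : X → MTL X
  _∧_  : MTL X → MTL X → MTL X
  _∨_  : MTL X → MTL X → MTL X
  ◇    : MTL X → MTL X
  □    : MTL X → MTL X
  ∼_   : MTL X → MTL X

infix 3 _∣_⊨MTL_

_∣_⊨MTL_ : {X : Set} (M : KripkeModel X) → Team M → MTL X → Set₁
M ∣ T ⊨MTL var p   = Pos M p T
M ∣ T ⊨MTL ¬var p  = Neg M p T
M ∣ T ⊨MTL (φ ∧ ψ) = And M (M ∣_⊨MTL φ) (M ∣_⊨MTL ψ) T
M ∣ T ⊨MTL (φ ∨ ψ) = Or M (M ∣_⊨MTL φ) (M ∣_⊨MTL ψ) T
M ∣ T ⊨MTL ◇ φ     = Diamond M (M ∣_⊨MTL φ) T
M ∣ T ⊨MTL □ φ     = Box M (M ∣_⊨MTL φ) T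
M ∣ T ⊨MTL (∼ φ)   = ¬ (M ∣ T ⊨MTL φ)

------------------------------------------------------------------------
-- First-order logic without identity over n unary relation symbols

-- `FO n k` has its free variables, as de Bruijn indices, in `Fin k`.
data FO (n : ℕ) : ℕ → Set where
  rel  : ∀ {k} → Fin n → Fin k → FO n k
  ¬'_  : ∀ {k} → FO n k → FO n k
  _∧'_ : ∀ {k} → FO n k → FO n k → FO n k
  _∨'_ : ∀ {k} → FO n k → FO n k → FO n k
  ∃'   : ∀ {k} → FO n (suc k) → FO n k
  ∀'   : ∀ {k} → FO n (suc k) → FO n k

Sentence : ℕ → Set
Sentence n = FO n 0

record Structure (n : ℕ) : Set₂ where
  field
    Universe : Set        -- possibly empty
    ⟦_⟧      : Fin n → Pred Universe (lsuc 0ℓ)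

evalFO : ∀ {n k} (𝒜 : Structure n) →
         FO n k → Vector (Structure.Universe 𝒜) k → Set₁
evalFO 𝒜 (rel i x) ρ = Structure.⟦_⟧ 𝒜 i (ρ x)
evalFO 𝒜 (¬' φ)    ρ = ¬ evalFO 𝒜 φ ρ
evalFO 𝒜 (φ ∧' ψ)  ρ = evalFO 𝒜 φ ρ × evalFO 𝒜 ψ ρ
evalFO 𝒜 (φ ∨' ψ)  ρ = evalFO 𝒜 φ ρ ⊎ evalFO 𝒜 ψ ρ
evalFO 𝒜 (∃' φ)    ρ = Σ[ a ∈ Structure.Universe 𝒜 ] evalFO 𝒜 φ (a Vector.∷ ρ)
evalFO 𝒜 (∀' φ)    ρ = (a : Structure.Universe 𝒜) → evalFO 𝒜 φ (a Vector.∷ ρ)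

infix 3 _⊨FO_

_⊨FO_ : ∀ {n} → Structure n → Sentence n → Set₁
𝒜 ⊨FO φ = evalFO 𝒜 φ Vector.[]

-- The universe is the team as a type. A world may be paired with several
-- proofs of membership, but the relations ignore the proof, so formulas
-- without equality cannot tell such copies apart.
teamStructure : {X : Set} {n : ℕ} (M : KripkeModel X) →
                Team M → Vec (ML X) n → Structure n
teamStructure M T φs = record
  { Universe = Σ (World M) T
  ; ⟦_⟧      = λ i a → M ∣ ｛ proj₁ a ｝ ⊨ML lookup φs i
  }

------------------------------------------------------------------------
-- Modal logic with all dependence atoms definable in FO without identity

-- `D φ φs` is the atom D_φ applied to the ML-formulas φs.
data MLFO (X : Set) : Set where
  var  : X → MLFO X
  ¬var : X → MLFO X
  _∧_  : MLFO X → MLFO X → MLFO X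
  _∨_  : MLFO X → MLFO X → MLFO X
  ◇    : MLFO X → MLFO X
  □    : MLFO X → MLFO X
  D    : {n : ℕ} → Sentence n → Vec (ML X) n → MLFO X

infix 3 _∣_⊨MLFO_

_∣_⊨MLFO_ : {X : Set} (M : KripkeModel X) → Team M → MLFO X → Set₁
M ∣ T ⊨MLFO var p   = Pos M p T
M ∣ T ⊨MLFO ¬var p  = Neg M p T
M ∣ T ⊨MLFO (φ ∧ ψ) = And M (M ∣_⊨MLFO φ) (M ∣_⊨MLFO ψ) T
M ∣ T ⊨MLFO (φ ∨ ψ) = Or M (M ∣_⊨MLFO φ) (M ∣_⊨MLFO ψ) T
M ∣ T ⊨MLFO ◇ φ     = Diamond M (M ∣_⊨MLFO φ) T
M ∣ T ⊨MLFO □ φ     = Box M (M ∣_⊨MLFO φ) T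
M ∣ T ⊨MLFO D φ φs  = teamStructure M T φs ⊨FO φ

------------------------------------------------------------------------
-- Team properties and expressibility

record TeamModel (X : Set) : Set₁ where
  field
    model    : KripkeModel X
    team     : Team model
    nonempty : ¬ Empty team

TeamProperty : Set → (ℓ : Level) → Set (lsuc 0ℓ ⊔ lsuc ℓ)
TeamProperty X ℓ = Pred (TeamModel X) ℓ

ExpressibleIn : {X : Set} {ℓ : Level} (L : Set) →
                ((M : KripkeModel X) → Team M → L → Set₁) →
                TeamProperty X ℓ → Set (lsuc 0ℓ ⊔ ℓ)
ExpressibleIn L _∣_⊨_ P =
  ∃ λ (φ : L) → P ≐ λ 𝑀 → TeamModel.model 𝑀 ∣ TeamModel.team 𝑀 ⊨ φ

ExpressibleInMLFO : {X : Set} {ℓ : Level} → TeamProperty X ℓ → Set (lsuc 0ℓ ⊔ ℓ)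
ExpressibleInMLFO {X} = ExpressibleIn (MLFO X) _∣_⊨MLFO_

ExpressibleInMTL : {X : Set} {ℓ : Level} → TeamProperty X ℓ → Set (lsuc 0ℓ ⊔ ℓ)
ExpressibleInMTL {X} = ExpressibleIn (MTL X) _∣_⊨MTL_

{-# OPTIONS --safe #-}
-- Both logics are invariant under k-bisimilarity of teams for some k depending
-- on the formula: teams T and U are k-bisimilar when every world of either has
-- a k-bisimilar world in the other.  As X is finite, finitely many ML-formulas
-- `chars k` classify worlds up to k-bisimilarity, so a team is determined up to
-- k-bisimilarity by which of these formulas are true at one of its worlds.
-- Hence every invariant property is a Boolean combination of statements "χ is
-- true at some world of T", which MTL expresses as ∼ ¬χ, and the Boolean
-- combination itself is a single first-order atom applied to `chars k`.
module Submission where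

open import Defs
open import Axiom.ExcludedMiddle using (ExcludedMiddle)
open import Data.Empty using (⊥-elim)
open import Data.Fin using (Fin; zero; suc)
open import Data.List using (List; []; _∷_; _++_; map; filter; length; allFin; cartesianProductWith)
import Data.List.Membership.Propositional as List
open import Data.List.Membership.Propositional.Properties
  using ( ∈-map⁺; ∈-++⁺ˡ; ∈-++⁺ʳ; ∈-filter⁺; ∈-filter⁻; ∈-allFin
        ; ∈-cartesianProductWith⁺; ∈-cartesianProductWith⁻)
open import Data.List.Relation.Unary.Any using (here; there)
open import Data.Nat using (ℕ; zero; suc; _≤_; _⊔_; s≤s)
open import Data.Nat.Properties using (≤-refl; m⊔n≤o⇒m≤o; m⊔n≤o⇒n≤o)
open import Data.Product using (Σ; ∃; _×_; _,_; proj₁; proj₂)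
open import Data.Product.Function.NonDependent.Propositional using (_×-⇔_)
open import Data.Sum as Sum using (inj₁; inj₂; [_,_])
open import Data.Sum.Function.Propositional using (_⊎-⇔_)
open import Data.Vec using (Vec; []; _∷_; lookup; fromList)
import Data.Vec.Functional as Vector
open Vector using (Vector)
open import Data.Vec.Membership.Propositional.Properties using (∈-fromList⁺)
import Data.Vec.Relation.Unary.Any as VecAny
open import Data.Vec.Relation.Unary.Any.Properties using (lookup-index)
open import Function.Base using (_∘_)
open import Function.Bundles using (_↔_; _⇔_; mk⇔; module Equivalence; module Inverse)
open import Function.Construct.Symmetry using (⇔-sym)
open import Function.Related.TypeIsomorphisms using (¬-cong-⇔)
open import Level using (Level; lift; 0ℓ) renaming (suc to lsuc)
open import Relation.Binary using (REL)
open import Relation.Binary.PropositionalEquality using (_≡_; refl; subst)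
open import Relation.Nullary using (¬_; yes; no)
open import Relation.Unary using (Pred; _∈_; _∉_; _⊆_; _∩_; _∪_; ∁; ｛_｝)

open Equivalence
open KripkeModel using (R; π)
open TeamSemantics

variable
  X : Set
  A B : Set

-- Matchings and bisimulations

-- The Egli-Milner lifting of `Z` from points to subsets.
Matching : REL A B 0ℓ → Pred A 0ℓ → Pred B 0ℓ → Set
Matching Z T U = (∀ {w} → w ∈ T → ∃ λ v → v ∈ U × Z w v)
               × (∀ {v} → v ∈ U → ∃ λ w → w ∈ T × Z w v)

Matching-sym : {Z : REL A B 0ℓ} {Z′ : REL B A 0ℓ} → (∀ {w v} → Z w v → Z′ v w) →
               ∀ {T U} → Matching Z T U → Matching Z′ U T
Matching-sym Z⇒Z′ (forth , back) =
    (λ v∈U → let w , w∈T , z = back v∈U in w , w∈T , Z⇒Z′ z)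
  , (λ w∈T → let v , v∈U , z = forth w∈T in v , v∈U , Z⇒Z′ z)

PointedModel : Set → Set₁
PointedModel X = Σ (KripkeModel X) World

AtomEquivalent : PointedModel X → PointedModel X → Set
AtomEquivalent (M , w) (N , v) = ∀ p → w ∈ π M p ⇔ v ∈ π N p

mutual
  Bisim : ℕ → PointedModel X → PointedModel X → Set
  Bisim zero    𝑤 𝑣 = AtomEquivalent 𝑤 𝑣
  Bisim (suc k) 𝑤@(M , w) 𝑣@(N , v) = AtomEquivalent 𝑤 𝑣 × TeamBisim k M N (R M w) (R N v)

  TeamBisim : ℕ → (M N : KripkeModel X) → Team M → Team N → Set
  TeamBisim k M N = Matching (λ w v → Bisim k (M , w) (N , v))

Bisim⇒AtomEquivalent : ∀ k {𝑤 𝑣 : PointedModel X} → Bisim k 𝑤 𝑣 → AtomEquivalent 𝑤 𝑣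
Bisim⇒AtomEquivalent zero    z = z
Bisim⇒AtomEquivalent (suc k) z = proj₁ z

Bisim-sym : ∀ k {𝑤 𝑣 : PointedModel X} → Bisim k 𝑤 𝑣 → Bisim k 𝑣 𝑤
Bisim-sym zero    z       = ⇔-sym ∘ z
Bisim-sym (suc k) (z , m) = ⇔-sym ∘ z , Matching-sym (Bisim-sym k) m

TeamBisim-sym : ∀ k {M N : KripkeModel X} {T U} → TeamBisim k M N T U → TeamBisim k N M U T
TeamBisim-sym k = Matching-sym (Bisim-sym k)

-- Invariance of team semantics

Property : Set → Set₂
Property X = (M : KripkeModel X) → Pred (Team M) (lsuc 0ℓ)

Invariant : ℕ → Property X → Set₁
Invariant k P = ∀ {M N T U} → TeamBisim k M N T U → P M T → P N U

-- Asking for every `j` above `k` lets the depths of subformulas be joined by `_⊔_` directly, with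
-- no passage from `j`-bisimilarity down to `k`-bisimilarity.
EventuallyInvariant : Property X → Set₁
EventuallyInvariant P = ∃ λ k → ∀ {j} → k ≤ j → Invariant j P

Pos-invariant : (p : X) → EventuallyInvariant (λ M → Pos M p)
Pos-invariant p = 0 , λ { {j} _ (_ , back) (lift T⊆p) → lift λ v∈U →
  let w , w∈T , z = back v∈U in to (Bisim⇒AtomEquivalent j z p) (T⊆p w∈T) }

Neg-invariant : (p : X) → EventuallyInvariant (λ M → Neg M p)
Neg-invariant p = 0 , λ { {j} _ (_ , back) (lift T∩p) → lift λ { v (v∈U , v∈p) →
  let w , w∈T , z = back v∈U in T∩p w (w∈T , from (Bisim⇒AtomEquivalent j z p) v∈p) } }

And-invariant : {P Q : Property X} → EventuallyInvariant P → EventuallyInvariant Q →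
                EventuallyInvariant (λ M → And M (P M) (Q M))
And-invariant (k , P-inv) (l , Q-inv) = k ⊔ l , λ k⊔l≤j z (p , q) →
  P-inv (m⊔n≤o⇒m≤o k l k⊔l≤j) z p , Q-inv (m⊔n≤o⇒n≤o k l k⊔l≤j) z q

-- The part of `U` chosen consists of the partners of `T₁`, so back holds by construction and forth
-- is inherited. This transports the witness teams of `_∨_` and `◇`.
Matching-restrict : {Z : REL A B 0ℓ} {T : Pred A 0ℓ} {U : Pred B 0ℓ} → Matching Z T U →
                    ∀ {T₁} → T₁ ⊆ T → Matching Z T₁ (λ v → v ∈ U × ∃ λ w → w ∈ T₁ × Z w v)
Matching-restrict (forth , _) T₁⊆T =
    (λ {w} w∈T₁ → let v , v∈U , z = forth (T₁⊆T w∈T₁) in v , (v∈U , w , w∈T₁ , z) , z)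
  , proj₂

Or-invariant : {P Q : Property X} → EventuallyInvariant P → EventuallyInvariant Q →
               EventuallyInvariant (λ M → Or M (P M) (Q M))
Or-invariant (k , P-inv) (l , Q-inv) = k ⊔ l ,
  λ { k⊔l≤j m@(_ , back) (T₁ , T₂ , (T⊆T₁∪T₂ , T₁∪T₂⊆T) , p , q) →
    -- `U` is split into the partners of `T₁` and those of `T₂`. They cover `U` because each of its
    -- worlds has a partner in `T`.
    _ , _
    , ( (λ {v} v∈U → let w , w∈T , z = back v∈U in
          Sum.map (λ w∈T₁ → v∈U , w , w∈T₁ , z) (λ w∈T₂ → v∈U , w , w∈T₂ , z) (T⊆T₁∪T₂ w∈T))
      , [ proj₁ , proj₁ ])
    , P-inv (m⊔n≤o⇒m≤o k l k⊔l≤j) (Matching-restrict m (T₁∪T₂⊆T ∘ inj₁)) p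
    , Q-inv (m⊔n≤o⇒n≤o k l k⊔l≤j) (Matching-restrict m (T₁∪T₂⊆T ∘ inj₂)) q }

-- Unfolding one level of bisimilarity matches the successors, which is why `□` and `◇` raise the
-- depth by one.
image-TeamBisim : ∀ k {M N : KripkeModel X} {T U} → TeamBisim (suc k) M N T U →
                  TeamBisim k M N (image M T) (image N U)
image-TeamBisim k (forth , back) =
    (λ (w , w∈T , r) → let v , v∈U , _ , succs , _ = forth w∈T
                           v′ , r′ , z = succs r
                       in v′ , (v , v∈U , r′) , z)
  , (λ (v , v∈U , r) → let w , w∈T , _ , _ , succs = back v∈U
                           w′ , r′ , z = succs r
                       in w′ , (w , w∈T , r′) , z)

Box-invariant : {P : Property X} → EventuallyInvariant P → EventuallyInvariant (λ M → Box M (P M))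
Box-invariant (k , P-inv) = suc k , λ { {suc j} (s≤s k≤j) m → P-inv k≤j (image-TeamBisim j m) }

Diamond-invariant : {P : Property X} → EventuallyInvariant P →
                    EventuallyInvariant (λ M → Diamond M (P M))
Diamond-invariant (k , P-inv) = suc k ,
  λ { {suc j} (s≤s k≤j) m@(_ , back) (T′ , p , forth , back′) →
    -- The witness is the set of worlds of `image N U` with a partner in `T′`; by `back′`, `T′` lies
    -- inside `image M T`.
    _
    , P-inv k≤j (Matching-restrict (image-TeamBisim j m) λ {w′} → back′ w′) p
    , (λ v v∈U → let w , w∈T , _ , succs , _ = back v∈U
                     w′ , w′∈T′ , r = forth w w∈T
                     v′ , r′ , z = succs r
                 in v′ , ((v , v∈U , r′) , w′ , w′∈T′ , z) , r′)
    , (λ _ → proj₁) }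

-- Negation reverses the implication, so the symmetry of team bisimilarity is used at the same
-- depth.
∼-invariant : {P : Property X} → EventuallyInvariant P → EventuallyInvariant (λ M T → ¬ P M T)
∼-invariant (k , P-inv) = k , λ {j} k≤j m ¬p p → ¬p (P-inv k≤j (TeamBisim-sym j m) p)

ML-invariant : (φ : ML X) → EventuallyInvariant (λ M → M ∣_⊨ML φ)
ML-invariant (var p)  = Pos-invariant p
ML-invariant (¬var p) = Neg-invariant p
ML-invariant (φ ∧ ψ)  = And-invariant (ML-invariant φ) (ML-invariant ψ)
ML-invariant (φ ∨ ψ)  = Or-invariant (ML-invariant φ) (ML-invariant ψ)
ML-invariant (◇ φ)    = Diamond-invariant (ML-invariant φ)
ML-invariant (□ φ)    = Box-invariant (ML-invariant φ)

MTL-invariant : (φ : MTL X) → EventuallyInvariant (λ M → M ∣_⊨MTL φ)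
MTL-invariant (var p)  = Pos-invariant p
MTL-invariant (¬var p) = Neg-invariant p
MTL-invariant (φ ∧ ψ)  = And-invariant (MTL-invariant φ) (MTL-invariant ψ)
MTL-invariant (φ ∨ ψ)  = Or-invariant (MTL-invariant φ) (MTL-invariant ψ)
MTL-invariant (◇ φ)    = Diamond-invariant (MTL-invariant φ)
MTL-invariant (□ φ)    = Box-invariant (MTL-invariant φ)
MTL-invariant (∼ φ)    = ∼-invariant (MTL-invariant φ)

-- First-order evaluation and dependence atoms

open Structure using (Universe; ⟦_⟧)

module _ {n} {𝒜 ℬ : Structure n}
         {Z : Universe 𝒜 → Universe ℬ → Set}
         (related : ∀ {a b} → Z a b → ∀ i → ⟦ 𝒜 ⟧ i a ⇔ ⟦ ℬ ⟧ i b)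
         (forth : ∀ a → ∃ (Z a)) (back : ∀ b → ∃ λ a → Z a b) where

  ∷-related : ∀ {k a b} {ρ : Vector (Universe 𝒜) k} {σ : Vector (Universe ℬ) k} →
              Z a b → (∀ x → Z (ρ x) (σ x)) → ∀ x → Z ((a Vector.∷ ρ) x) ((b Vector.∷ σ) x)
  ∷-related z zs zero    = z
  ∷-related z zs (suc x) = zs x

  -- In the absence of identity, a relation that is total on both sides and respects the relation
  -- symbols preserves all formulas: `forth` and `back` supply partners for the quantified elements.
  evalFO-invariant : ∀ {k} (φ : FO n k) {ρ σ} → (∀ x → Z (ρ x) (σ x)) →
                     evalFO 𝒜 φ ρ ⇔ evalFO ℬ φ σ
  evalFO-invariant (rel i x) zs = related (zs x) i
  evalFO-invariant (¬' φ)    zs = ¬-cong-⇔ (evalFO-invariant φ zs)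
  evalFO-invariant (φ ∧' ψ)  zs = evalFO-invariant φ zs ×-⇔ evalFO-invariant ψ zs
  evalFO-invariant (φ ∨' ψ)  zs = evalFO-invariant φ zs ⊎-⇔ evalFO-invariant ψ zs
  evalFO-invariant (∃' φ)    zs = mk⇔
    (λ (a , h) → let b , z = forth a in b , to   (evalFO-invariant φ (∷-related z zs)) h)
    (λ (b , h) → let a , z = back b  in a , from (evalFO-invariant φ (∷-related z zs)) h)
  evalFO-invariant (∀' φ)    zs = mk⇔
    (λ h b → let a , z = back b  in to   (evalFO-invariant φ (∷-related z zs)) (h a))
    (λ h a → let b , z = forth a in from (evalFO-invariant φ (∷-related z zs)) (h b))

lookup-invariant : ∀ {n} (φs : Vec (ML X) n) →
                   ∃ λ k → ∀ {j} → k ≤ j → ∀ i → Invariant j (λ M → M ∣_⊨ML lookup φs i)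
lookup-invariant []       = 0 , λ _ ()
lookup-invariant (φ ∷ φs) =
  let k , φ-inv  = ML-invariant φ
      l , φs-inv = lookup-invariant φs
  in k ⊔ l , λ { k⊔l≤j zero    → φ-inv (m⊔n≤o⇒m≤o k l k⊔l≤j)
               ; k⊔l≤j (suc i) → φs-inv (m⊔n≤o⇒n≤o k l k⊔l≤j) i }

D-invariant : ∀ {n} (φ : Sentence n) (φs : Vec (ML X) n) →
              EventuallyInvariant (λ M T → teamStructure M T φs ⊨FO φ)
D-invariant φ φs = let k , φs-inv = lookup-invariant φs in k ,
  λ { {j} k≤j {M} {N} (forth , back) → to (evalFO-invariant
    -- Only the worlds are compared, not the membership proofs. Relation symbols are evaluated at
    -- singletons, and these are matched when their worlds are.
    {Z = λ (w , _) (v , _) → Bisim j (M , w) (N , v)}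
    (λ {(w , _)} {(v , _)} z i → let m = singletons j M N z in
      mk⇔ (φs-inv k≤j i m) (φs-inv k≤j i (TeamBisim-sym j m)))
    (λ (w , w∈T) → let v , v∈U , z = forth w∈T in (v , v∈U) , z)
    (λ (v , v∈U) → let w , w∈T , z = back v∈U in (w , w∈T) , z)
    φ λ ()) }
  where
  singletons : ∀ j M N {w v} → Bisim j (M , w) (N , v) → TeamBisim j M N ｛ w ｝ ｛ v ｝
  singletons j M N z = (λ { refl → _ , refl , z }) , (λ { refl → _ , refl , z })

MLFO-invariant : (φ : MLFO X) → EventuallyInvariant (λ M → M ∣_⊨MLFO φ)
MLFO-invariant (var p)  = Pos-invariant p
MLFO-invariant (¬var p) = Neg-invariant p
MLFO-invariant (φ ∧ ψ)  = And-invariant (MLFO-invariant φ) (MLFO-invariant ψ)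
MLFO-invariant (φ ∨ ψ)  = Or-invariant (MLFO-invariant φ) (MLFO-invariant ψ)
MLFO-invariant (◇ φ)    = Diamond-invariant (MLFO-invariant φ)
MLFO-invariant (□ φ)    = Box-invariant (MLFO-invariant φ)
MLFO-invariant (D φ φs) = D-invariant φ φs

-- Flatness of ML

-- Kripke semantics at a world. Its values lie in `Set`, so truth sets can be intersected with teams
-- to form new teams.
Truth : (M : KripkeModel X) → ML X → Pred (World M) 0ℓ
Truth M (var p)  = π M p
Truth M (¬var p) = ∁ (π M p)
Truth M (φ ∧ ψ)  = Truth M φ ∩ Truth M ψ
Truth M (φ ∨ ψ)  = Truth M φ ∪ Truth M ψ
Truth M (◇ φ) w  = ∃ λ v → v ∈ R M w × v ∈ Truth M φ
Truth M (□ φ) w  = R M w ⊆ Truth M φ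

fromML : ML X → MTL X
fromML (var p)  = var p
fromML (¬var p) = ¬var p
fromML (φ ∧ ψ)  = fromML φ ∧ fromML ψ
fromML (φ ∨ ψ)  = fromML φ ∨ fromML ψ
fromML (◇ φ)    = ◇ (fromML φ)
fromML (□ φ)    = □ (fromML φ)

module _ {M : KripkeModel X} where

  -- Stated for arbitrary team predicates, so that each connective is treated once for both `ML` and
  -- its copy inside `MTL`.
  Flat : Pred (Team M) (lsuc 0ℓ) → Pred (World M) 0ℓ → Set₁
  Flat P A = ∀ T → P T ⇔ (∀ w → w ∈ T → w ∈ A)

  Pos-flat : ∀ p → Flat (Pos M p) (π M p)
  Pos-flat p T = mk⇔ (λ (lift h) w w∈T → h w∈T) (λ h → lift λ {w} w∈T → h w w∈T)

  Neg-flat : ∀ p → Flat (Neg M p) (∁ (π M p))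
  Neg-flat p T = mk⇔ (λ (lift h) w w∈T w∈p → h w (w∈T , w∈p))
                     (λ h → lift λ w (w∈T , w∈p) → h w w∈T w∈p)

  module _ {P Q A B} (P-flat : Flat P A) (Q-flat : Flat Q B) where

    And-flat : Flat (And M P Q) (A ∩ B)
    And-flat T = mk⇔
      (λ (p , q) w w∈T → to (P-flat T) p w w∈T , to (Q-flat T) q w w∈T)
      (λ h → from (P-flat T) (λ w w∈T → proj₁ (h w w∈T))
           , from (Q-flat T) (λ w w∈T → proj₂ (h w w∈T)))

    Or-flat : Flat (Or M P Q) (A ∪ B)
    Or-flat T = mk⇔
      (λ (T₁ , T₂ , (T⊆T₁∪T₂ , _) , p , q) w w∈T →
        Sum.map (to (P-flat T₁) p w) (to (Q-flat T₂) q w) (T⊆T₁∪T₂ w∈T))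
      (λ h → T ∩ A , T ∩ B
        , ( (λ {w} w∈T → Sum.map (w∈T ,_) (w∈T ,_) (h w w∈T))
          , λ {w} → [ proj₁ , proj₁ ])
        , from (P-flat (T ∩ A)) (λ _ → proj₂) , from (Q-flat (T ∩ B)) (λ _ → proj₂))

  module _ {P A} (P-flat : Flat P A) where

    Diamond-flat : Flat (Diamond M P) (λ w → ∃ λ v → v ∈ R M w × v ∈ A)
    Diamond-flat T = mk⇔
      (λ (T′ , p , forth , _) w w∈T →
        let v , v∈T′ , r = forth w w∈T in v , r , to (P-flat T′) p v v∈T′)
      -- The largest candidate team is taken: all successors of `T` that lie in `A`.
      (λ (h : ∀ w → w ∈ T → ∃ λ v → v ∈ R M w × v ∈ A) →
        image M T ∩ A
        , from (P-flat (image M T ∩ A)) (λ _ → proj₂)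
        , (λ w w∈T → let v , r , a = h w w∈T in v , ((w , w∈T , r) , a) , r)
        , λ _ → proj₁)

    Box-flat : Flat (Box M P) (λ w → R M w ⊆ A)
    Box-flat T = mk⇔ (λ p w w∈T {v} r → to (P-flat (image M T)) p v (w , w∈T , r))
                     (λ h → from (P-flat (image M T)) λ v (w , w∈T , r) → h w w∈T r)

  ML-flat : (φ : ML X) → Flat (M ∣_⊨ML φ) (Truth M φ)
  ML-flat (var p)  = Pos-flat p
  ML-flat (¬var p) = Neg-flat p
  ML-flat (φ ∧ ψ)  = And-flat (ML-flat φ) (ML-flat ψ)
  ML-flat (φ ∨ ψ)  = Or-flat (ML-flat φ) (ML-flat ψ)
  ML-flat (◇ φ)    = Diamond-flat (ML-flat φ)
  ML-flat (□ φ)    = Box-flat (ML-flat φ)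

  fromML-flat : (φ : ML X) → Flat (M ∣_⊨MTL fromML φ) (Truth M φ)
  fromML-flat (var p)  = Pos-flat p
  fromML-flat (¬var p) = Neg-flat p
  fromML-flat (φ ∧ ψ)  = And-flat (fromML-flat φ) (fromML-flat ψ)
  fromML-flat (φ ∨ ψ)  = Or-flat (fromML-flat φ) (fromML-flat ψ)
  fromML-flat (◇ φ)    = Diamond-flat (fromML-flat φ)
  fromML-flat (□ φ)    = Box-flat (fromML-flat φ)

  ⊨ML-singleton : (φ : ML X) {w : World M} → (M ∣ ｛ w ｝ ⊨ML φ) ⇔ w ∈ Truth M φ
  ⊨ML-singleton φ = mk⇔ (λ h → to (ML-flat φ _) h _ refl)
                        (λ t → from (ML-flat φ _) λ { _ refl → t })

-- Definability by Boolean combinations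

-- One normal form argument is to serve `ML` at worlds, and both `MTL` and first-order sentences on
-- teams. The field `formula` is a seed from which `falsum` is built.
record BooleanLogic (Point : Set₁) (ℓ : Level) : Set (lsuc ℓ) where
  infix  4 _⊨_
  infixr 7 _⊓_
  field
    Formula : Set
    _⊨_     : Point → Formula → Set ℓ
    formula : Formula
    _⊓_     : Formula → Formula → Formula
    neg     : Formula → Formula
    ⊨-⊓     : ∀ {𝑝} φ ψ → 𝑝 ⊨ φ ⊓ ψ ⇔ (𝑝 ⊨ φ × 𝑝 ⊨ ψ)
    ⊨-neg   : ∀ {𝑝} φ → 𝑝 ⊨ neg φ ⇔ (¬ 𝑝 ⊨ φ)

module Classical (em : ∀ ℓ → ExcludedMiddle ℓ) where

  stable : ∀ {ℓ} {P : Set ℓ} → ¬ ¬ P → P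
  stable {ℓ} {P} ¬¬p with em ℓ {P}
  ... | yes p = p
  ... | no ¬p = ⊥-elim (¬¬p ¬p)

  module Definability {Point : Set₁} {ℓ} (𝓛 : BooleanLogic Point ℓ) where
    open BooleanLogic 𝓛

    Agree : List Formula → Point → Point → Set ℓ
    Agree L 𝑝 𝑞 = ∀ {φ} → φ List.∈ L → 𝑝 ⊨ φ ⇔ 𝑞 ⊨ φ

    falsum verum : Formula
    falsum = formula ⊓ neg formula
    verum  = neg falsum

    ⊭-falsum : ∀ {𝑝} → ¬ 𝑝 ⊨ falsum
    ⊭-falsum h = let p , ¬p = to (⊨-⊓ _ _) h in to (⊨-neg _) ¬p p

    -- The complete conjunctions over `L`, containing each member either plainly or negated.
    describe : List Formula → List Formula
    describe []      = verum ∷ []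
    describe (φ ∷ L) = cartesianProductWith _⊓_ (φ ∷ neg φ ∷ []) (describe L)

    describe-complete : ∀ L 𝑝 → ∃ λ χ → χ List.∈ describe L × 𝑝 ⊨ χ
    describe-complete []      𝑝 = _ , here refl , from (⊨-neg _) ⊭-falsum
    describe-complete (φ ∷ L) 𝑝 with describe-complete L 𝑝 | em ℓ {𝑝 ⊨ φ}
    ... | χ , χ∈ , c | yes p = _ , ∈-cartesianProductWith⁺ _⊓_ {xs = φ ∷ neg φ ∷ []} (here refl) χ∈
                                 , from (⊨-⊓ _ _) (p , c)
    ... | χ , χ∈ , c | no ¬p = _ , ∈-cartesianProductWith⁺ _⊓_ {xs = φ ∷ neg φ ∷ []} (there (here refl)) χ∈
                                 , from (⊨-⊓ _ _) (from (⊨-neg _) ¬p , c)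

    -- A description fixes the sign of every member of `L`, so two points satisfying it cannot
    -- differ on any of them.
    describe-sound : ∀ L {χ 𝑝 𝑞} → χ List.∈ describe L → 𝑝 ⊨ χ → 𝑞 ⊨ χ → Agree L 𝑝 𝑞
    describe-sound (φ ∷ L) χ∈ c d φ∈
      with ∈-cartesianProductWith⁻ _⊓_ (φ ∷ neg φ ∷ []) (describe L) χ∈
    ... | _ , _ , l∈ , χ∈′ , refl with to (⊨-⊓ _ _) c | to (⊨-⊓ _ _) d
    describe-sound (φ ∷ L) _ _ _ (there φ∈) | _ , _ , _ , χ∈′ , refl | _ , c | _ , d =
      describe-sound L χ∈′ c d φ∈
    describe-sound (φ ∷ L) _ _ _ (here refl) | _ , _ , here refl , _ , refl | p , _ | q , _ =
      mk⇔ (λ _ → q) (λ _ → p)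
    describe-sound (φ ∷ L) _ _ _ (here refl) | _ , _ , there (here refl) , _ , refl | p , _ | q , _ =
      mk⇔ (λ h → ⊥-elim (to (⊨-neg _) p h)) (λ h → ⊥-elim (to (⊨-neg _) q h))

    disjunction : List Formula → Formula
    disjunction []      = falsum
    disjunction (φ ∷ L) = neg (neg φ ⊓ neg (disjunction L))

    ⊨-disjunction : ∀ L {𝑝} → 𝑝 ⊨ disjunction L ⇔ (∃ λ φ → φ List.∈ L × 𝑝 ⊨ φ)
    ⊨-disjunction []      = mk⇔ (λ h → ⊥-elim (⊭-falsum h)) λ ()
    ⊨-disjunction (φ ∷ L) {𝑝} = mk⇔
      (λ h → stable λ none → to (⊨-neg _) h (from (⊨-⊓ _ _)
        ( from (⊨-neg _) (λ p → none (φ , here refl , p))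
        , from (⊨-neg _) (λ d → let ψ , ψ∈ , q = to (⊨-disjunction L) d in none (ψ , there ψ∈ , q)))))
      (λ (ψ , ψ∈ , q) → from (⊨-neg _) λ h → let ¬p , ¬d = to (⊨-⊓ _ _) h in refute ψ∈ q ¬p ¬d)
      where
      refute : ∀ {ψ} → ψ List.∈ φ ∷ L → 𝑝 ⊨ ψ → 𝑝 ⊨ neg φ → ¬ 𝑝 ⊨ neg (disjunction L)
      refute (here refl) q ¬p ¬d = to (⊨-neg _) ¬p q
      refute (there ψ∈)  q ¬p ¬d = to (⊨-neg _) ¬d (from (⊨-disjunction L) (_ , ψ∈ , q))

    -- Disjunctive normal form: the descriptions that hold at some point of `Q` are joined. Points
    -- sharing a description agree on `L`, so one point in `Q` brings in all the others.
    definable : ∀ L {q} (Q : Pred Point q) → (∀ {𝑝 𝑞} → Agree L 𝑝 𝑞 → Q 𝑝 → Q 𝑞) →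
                ∃ λ ψ → ∀ 𝑝 → 𝑝 ⊨ ψ ⇔ Q 𝑝
    definable L Q Q-inv = disjunction descriptions , λ 𝑝 → mk⇔
      (λ h → let χ , χ∈ , c = to (⊨-disjunction descriptions) h
                 χ∈′ , 𝑞 , d , q = ∈-filter⁻ compatible? {xs = describe L} χ∈
             in Q-inv (describe-sound L χ∈′ d c) q)
      (λ q → let χ , χ∈ , c = describe-complete L 𝑝 in
        from (⊨-disjunction descriptions) (χ , ∈-filter⁺ compatible? χ∈ (𝑝 , c , q) , c))
      where
      Compatible : Formula → Set _
      Compatible χ = ∃ λ 𝑝 → 𝑝 ⊨ χ × Q 𝑝

      compatible? : ∀ χ → _
      -- `Compatible` quantifies over all points, so filtering by it rests on excluded middle.
      compatible? χ = em _ {Compatible χ}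

      descriptions : List Formula
      descriptions = filter compatible? (describe L)

  -- Negation pushed down to the variables, the only place where `ML` allows it.
  dual : ML X → ML X
  dual (var p)  = ¬var p
  dual (¬var p) = var p
  dual (φ ∧ ψ)  = dual φ ∨ dual ψ
  dual (φ ∨ ψ)  = dual φ ∧ dual ψ
  dual (◇ φ)    = □ (dual φ)
  dual (□ φ)    = ◇ (dual φ)

  dual-complete : (φ : ML X) {M : KripkeModel X} {w : World M} → w ∉ Truth M φ → w ∈ Truth M (dual φ)
  dual-complete (var p)  h = h
  dual-complete (¬var p) h = stable h
  dual-complete (φ ∧ ψ)  h = stable λ none →
    none (inj₁ (dual-complete φ λ a → none (inj₂ (dual-complete ψ λ b → h (a , b)))))
  dual-complete (φ ∨ ψ)  h = dual-complete φ (h ∘ inj₁) , dual-complete ψ (h ∘ inj₂)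
  dual-complete (◇ φ)    h r = dual-complete φ λ t → h (_ , r , t)
  dual-complete (□ φ)    h = stable λ none → h λ r → stable λ ¬t → none (_ , r , dual-complete φ ¬t)

  dual-sound : (φ : ML X) {M : KripkeModel X} {w : World M} → w ∈ Truth M (dual φ) → w ∉ Truth M φ
  dual-sound (var p)  h t = h t
  dual-sound (¬var p) h t = t h
  dual-sound (φ ∧ ψ)  h (a , b) = [ (λ h → dual-sound φ h a) , (λ h → dual-sound ψ h b) ] h
  dual-sound (φ ∨ ψ)  (h , h′) = [ dual-sound φ h , dual-sound ψ h′ ]
  dual-sound (◇ φ)    h (v , r , t) = dual-sound φ (h r) t
  dual-sound (□ φ)    (v , r , h) t = dual-sound φ h (t r)

  -- Characteristic formulas and definability over finitely many variables

  TeamPoint : Set → Set₁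
  TeamPoint X = Σ (KripkeModel X) Team

  module FiniteVariables {X : Set} (x : X) (variables : List X) (all : ∀ p → p List.∈ variables) where

    MLLogic : BooleanLogic (PointedModel X) 0ℓ
    MLLogic = record
      { Formula = ML X
      ; _⊨_     = λ (M , w) φ → w ∈ Truth M φ
      ; formula = var x
      ; _⊓_     = _∧_
      ; neg     = dual
      ; ⊨-⊓     = λ _ _ → mk⇔ (λ h → h) (λ h → h)
      ; ⊨-neg   = λ φ → mk⇔ (dual-sound φ) (dual-complete φ)
      }

    MTLLogic : BooleanLogic (TeamPoint X) (lsuc 0ℓ)
    MTLLogic = record
      { Formula = MTL X
      ; _⊨_     = λ (M , T) φ → M ∣ T ⊨MTL φ
      ; formula = var x
      ; _⊓_     = _∧_
      ; neg     = ∼_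
      ; ⊨-⊓     = λ _ _ → mk⇔ (λ h → h) (λ h → h)
      ; ⊨-neg   = λ _ → mk⇔ (λ h → h) (λ h → h)
      }

    -- With the arguments `φs` fixed, Boolean combinations, negation included, are formed inside the
    -- sentence of a single atom.
    atomLogic : ∀ {n} → Vec (ML X) (suc n) → BooleanLogic (TeamPoint X) (lsuc 0ℓ)
    atomLogic {n} φs = record
      { Formula = Sentence (suc n)
      ; _⊨_     = λ (M , T) φ → M ∣ T ⊨MLFO D φ φs
      ; formula = ∃' (rel zero zero)
      ; _⊓_     = _∧'_
      ; neg     = ¬'_
      ; ⊨-⊓     = λ _ _ → mk⇔ (λ h → h) (λ h → h)
      ; ⊨-neg   = λ _ → mk⇔ (λ h → h) (λ h → h)
      }

    open Definability MLLogic using (describe; describe-complete; describe-sound)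

    -- The Hintikka formulas of depth `k`: they settle each variable and, at positive depth, which
    -- formulas of the previous depth hold at some successor.
    distinguishers chars : ℕ → List (ML X)
    distinguishers zero    = map var variables
    distinguishers (suc k) = map var variables ++ map ◇ (chars k)
    chars k = describe (distinguishers k)

    Realised : ML X → Pred (TeamPoint X) 0ℓ
    Realised χ (M , T) = ∃ λ w → w ∈ T × w ∈ Truth M χ

    mutual
      chars-sound : ∀ k {χ 𝑤 𝑣} → χ List.∈ chars k →
                    proj₂ 𝑤 ∈ Truth (proj₁ 𝑤) χ → proj₂ 𝑣 ∈ Truth (proj₁ 𝑣) χ → Bisim k 𝑤 𝑣
      chars-sound zero    χ∈ t t′ p = describe-sound (distinguishers zero) χ∈ t t′ (∈-map⁺ var (all p))
      chars-sound (suc k) χ∈ t t′ =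
          (λ p → agree (∈-++⁺ˡ (∈-map⁺ var (all p))))
        -- Truth of `◇ ξ` at a world is by definition realisation of `ξ` in its set of successors.
        , realised⇒TeamBisim k (λ ξ∈ → agree (∈-++⁺ʳ (map var variables) (∈-map⁺ ◇ ξ∈)))
        where
        agree : ∀ {φ} → φ List.∈ distinguishers (suc k) → _
        agree = describe-sound (distinguishers (suc k)) χ∈ t t′

      -- Each world satisfies some `χ` in `chars k`; the other team realises this `χ`, and any world
      -- doing so is a bisimilar partner.
      realised⇒TeamBisim : ∀ k {M N T U} →
        (∀ {χ} → χ List.∈ chars k → Realised χ (M , T) ⇔ Realised χ (N , U)) → TeamBisim k M N T U
      realised⇒TeamBisim k {M} {N} same =
          (λ {w} w∈T → let χ , χ∈ , t = describe-complete (distinguishers k) (M , w)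
                           v , v∈U , t′ = to (same χ∈) (w , w∈T , t)
                       in v , v∈U , chars-sound k χ∈ t t′)
        , (λ {v} v∈U → let χ , χ∈ , t′ = describe-complete (distinguishers k) (N , v)
                           w , w∈T , t = from (same χ∈) (v , v∈U , t′)
                       in w , w∈T , chars-sound k χ∈ t t′)

    invariant⇒definable :
      ∀ {ℓ} (𝓛 : BooleanLogic (TeamPoint X) ℓ) → let open BooleanLogic 𝓛 in
      ∀ k (L : List Formula) →
      (∀ {χ} → χ List.∈ chars k → ∃ λ φ → φ List.∈ L × (∀ 𝑇 → 𝑇 ⊨ φ ⇔ Realised χ 𝑇)) →
      (P : Property X) → Invariant k P → ∃ λ ψ → ∀ M T → (M , T) ⊨ ψ ⇔ P M T
    invariant⇒definable 𝓛 k L realise P P-inv =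
      let ψ , ψ⇔P = definable L (λ (M , T) → P M T) λ {𝑇} {𝑈} agree →
            P-inv (realised⇒TeamBisim k λ χ∈ → let φ , φ∈ , φ⇔χ = realise χ∈ in
              mk⇔ (to (φ⇔χ 𝑈) ∘ to (agree φ∈) ∘ from (φ⇔χ 𝑇))
                  (to (φ⇔χ 𝑇) ∘ from (agree φ∈) ∘ from (φ⇔χ 𝑈)))
      in ψ , λ M T → ψ⇔P (M , T)
      where open Definability 𝓛 using (definable)

    definableInMTL : (P : Property X) → EventuallyInvariant P →
                     ∃ λ ψ → ∀ M T → (M ∣ T ⊨MTL ψ) ⇔ P M T
    definableInMTL P (k , P-inv) =
      -- By flatness, `dual χ` holds in `T` when every world of `T` refutes `χ`; `∼_` turns this
      -- into realisation of `χ`.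
      invariant⇒definable MTLLogic k (map (λ χ → ∼ fromML (dual χ)) (chars k))
        (λ {χ} χ∈ → _ , ∈-map⁺ _ χ∈ , λ (M , T) → mk⇔
          (λ h → stable λ none → h (from (fromML-flat (dual χ) T) λ w w∈T →
            dual-complete χ λ t → none (w , w∈T , t)))
          (λ (w , w∈T , t) h → dual-sound χ (to (fromML-flat (dual χ) T) h w w∈T) t))
        P (P-inv ≤-refl)

    definableInMLFO : (P : Property X) → EventuallyInvariant P →
                      ∃ λ ψ → ∀ M T → (M ∣ T ⊨MLFO ψ) ⇔ P M T
    definableInMLFO P (k , P-inv) =
      let ψ , ψ⇔P = invariant⇒definable (atomLogic φs) k (map realised (allFin _))
            -- The relation symbol for `χ` is its position in `φs`, where `VecAny.there` skips the
            -- leading `var x`.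
            (λ χ∈ → let χ∈φs = VecAny.there {x = var x} (∈-fromList⁺ χ∈) in
              _ , ∈-map⁺ realised (∈-allFin (VecAny.index χ∈φs)) , λ 𝑇 →
              ⊨-realised {VecAny.index χ∈φs} (lookup-index χ∈φs) 𝑇)
            P (P-inv ≤-refl)
      in D ψ φs , ψ⇔P
      where
      -- var x only ensures that there is a relation symbol at all: without
      -- identity, the empty signature has no sentences.
      φs : Vec (ML X) (suc (length (chars k)))
      φs = var x ∷ fromList (chars k)

      realised : Fin (suc (length (chars k))) → Sentence (suc (length (chars k)))
      realised i = ∃' (rel i zero)

      ⊨-realised : ∀ {i χ} → χ ≡ lookup φs i → ∀ 𝑇 →
                   (proj₁ 𝑇 ∣ proj₂ 𝑇 ⊨MLFO D (realised i) φs) ⇔ Realised χ 𝑇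
      ⊨-realised {i} refl 𝑇 = mk⇔
        (λ ((w , w∈T) , h) → w , w∈T , to (⊨ML-singleton (lookup φs i)) h)
        (λ (w , w∈T , t) → (w , w∈T) , from (⊨ML-singleton (lookup φs i)) t)

theorem4p5 : (∀ ℓ → ExcludedMiddle ℓ) →
    ∀ (X : Set) → X → ∃ (λ (n : ℕ) → X ↔ Fin n) →
    ∀ {ℓ} (P : TeamProperty X ℓ) → ExpressibleInMLFO P ⇔ ExpressibleInMTL P
theorem4p5 em X x (n , X↔Fin) P = mk⇔
  -- The translated formula agrees with `φ` on all teams, the empty one included, hence on the team
  -- models over which `P` ranges.
  (λ (φ , P⊆φ , φ⊆P) →
    let ψ , ψ⇔φ = definableInMTL (λ M → M ∣_⊨MLFO φ) (MLFO-invariant φ) in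
    ψ , (λ p → from (ψ⇔φ _ _) (P⊆φ p)) , (λ h → φ⊆P (to (ψ⇔φ _ _) h)))
  (λ (φ , P⊆φ , φ⊆P) →
    let ψ , ψ⇔φ = definableInMLFO (λ M → M ∣_⊨MTL φ) (MTL-invariant φ) in
    ψ , (λ p → from (ψ⇔φ _ _) (P⊆φ p)) , (λ h → φ⊆P (to (ψ⇔φ _ _) h)))
  where
  open Inverse X↔Fin using ()
    renaming (to to index; from to variable-at; strictlyInverseʳ to variable-at-index)
  open Classical em
  open FiniteVariables x (map variable-at (allFin n))
    (λ p → subst (List._∈ map variable-at (allFin n)) (variable-at-index p)
                 (∈-map⁺ variable-at (∈-allFin (index p))))
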